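{- For each $k \geq 2$, there exists a uniformly computable sequence $\langle f_i : i\in\omega\rangle$ of colorings $f_i\colon \omega \to k$ such that there is no $\emptyset'$-computable sequence $\langle A_i : i \in \omega\rangle$ of sets for which every $A_i$ is an infinite set thin for $f_i$.
   Context: A set $S\subseteq\omega$ is thin for $f\colon\omega\to k$ if there is $c<k$ with $f(x)\neq c$ for all $x \in S$. $\emptyset'$ denotes the halting set. -}

module Defs where

open import Data.Nat using (ℕ; zero; suc; _≤_; _<_; _%_; _/_)
open import Data.Fin using (Fin; toℕ)
open import Data.Bool using (Bool; true; false)
open import Data.List using (List; []; _∷_)
open import Data.Product using (Σ; _×_; _,_; ∃)
open import Data.Empty using (⊥)
open import Relation.Nullary using (¬_)
open import Relation.Binary.PropositionalEquality using (_≡_; _≢_)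

data Code : Set where
  zer  : Code
  sc   : Code
  proj : ℕ → Code                   -- i-th argument (0 if absent)
  comp : Code → List Code → Code
  prec : Code → Code → Code
  mu   : Code → Code
  orc  : Code

hd : List ℕ → ℕ
hd []      = 0
hd (x ∷ _) = x

nth : ℕ → List ℕ → ℕ
nth _       []       = 0
nth zero    (x ∷ _)  = x
nth (suc i) (_ ∷ xs) = nth i xs

mutual
  data Eval (X : ℕ → Set) : Code → List ℕ → ℕ → Set where
    e-zer  : ∀ {xs} → Eval X zer xs 0
    e-sc   : ∀ {xs} → Eval X sc xs (suc (hd xs))
    e-proj : ∀ {i xs} → Eval X (proj i) xs (nth i xs)
    e-comp : ∀ {f gs xs ys y} → EvalAll X gs xs ys → Eval X f ys y →
             Eval X (comp f gs) xs y
    e-prec0 : ∀ {f g xs y} → Eval X f xs y → Eval X (prec f g) (0 ∷ xs) y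
    e-precS : ∀ {f g n xs r y} → Eval X (prec f g) (n ∷ xs) r →
              Eval X g (n ∷ r ∷ xs) y → Eval X (prec f g) (suc n ∷ xs) y
    e-mu   : ∀ {f xs y} → Eval X f (y ∷ xs) 0 →
             (∀ z → z < y → Σ ℕ λ v → Eval X f (z ∷ xs) (suc v)) →
             Eval X (mu f) xs y
    e-orc1 : ∀ {xs} → X (hd xs) → Eval X orc xs 1
    e-orc0 : ∀ {xs} → ¬ X (hd xs) → Eval X orc xs 0

  data EvalAll (X : ℕ → Set) : List Code → List ℕ → List ℕ → Set where
    [] : ∀ {xs} → EvalAll X [] xs []
    _∷_ : ∀ {g gs xs y ys} → Eval X g xs y → EvalAll X gs xs ys →
          EvalAll X (g ∷ gs) xs (y ∷ ys)

-- Cantor enumeration of ℕ × ℕ (a computable bijection ℕ → ℕ × ℕ).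
unpair : ℕ → ℕ × ℕ
unpair zero = 0 , 0
unpair (suc n) with unpair n
... | zero  , b = suc b , 0
... | suc a , b = a , suc b

fstU sndU : ℕ → ℕ
fstU n with unpair n
... | a , _ = a
sndU n with unpair n
... | _ , b = b

mutual
  -- decodeF fuel n ; fuel n suffices since all sub-indices are < n
  decodeF : ℕ → ℕ → Code
  decodeF zero    _ = zer
  decodeF (suc F) n = byTag (n % 7) (n / 7)
    where
    byTag : ℕ → ℕ → Code
    byTag 0 m = zer
    byTag 1 m = sc
    byTag 2 m = proj m
    byTag 3 m = comp (decodeF F (fstU m)) (decodeListF F (sndU m))
    byTag 4 m = prec (decodeF F (fstU m)) (decodeF F (sndU m))
    byTag 5 m = mu (decodeF F m)
    byTag _ m = orc

  decodeListF : ℕ → ℕ → List Code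
  decodeListF zero    _       = []
  decodeListF (suc F) zero    = []
  decodeListF (suc F) (suc m) = decodeF F (fstU m) ∷ decodeListF F (sndU m)

φ : ℕ → Code
φ e = decodeF (suc e) e

∅ : ℕ → Set
∅ _ = ⊥

∅′ : ℕ → Set
∅′ e = Σ ℕ λ y → Eval ∅ (φ e) (e ∷ []) y

UniformlyComputableColorings : (k : ℕ) → (ℕ → ℕ → Fin k) → Set
UniformlyComputableColorings k f =
  Σ Code λ c → ∀ i x → Eval ∅ c (i ∷ x ∷ []) (toℕ (f i x))

bit : Bool → ℕ
bit true  = 1
bit false = 0

ComputableSeqOfSetsRel : (X : ℕ → Set) → (ℕ → ℕ → Bool) → Set
ComputableSeqOfSetsRel X A =
  Σ Code λ c → ∀ i x → Eval X c (i ∷ x ∷ []) (bit (A i x))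

Infinite : (ℕ → Bool) → Set
Infinite S = ∀ n → Σ ℕ λ m → n ≤ m × S m ≡ true

ThinFor : {k : ℕ} → (ℕ → Bool) → (ℕ → Fin k) → Set
ThinFor {k} S f = Σ (Fin k) λ c → ∀ x → S x ≡ true → f x ≢ c

{-# OPTIONS --safe #-}
module Submission where

open import Defs
open import Data.Nat
open import Data.Nat.DivMod
open import Data.Nat.Properties
open import Data.Bool using (Bool; true)
open import Data.Fin using (Fin; zero; suc; toℕ; fromℕ<)
open import Data.Fin.Properties using (toℕ-fromℕ<; toℕ<n; toℕ-injective; pigeonhole)
open import Data.List using (List; []; _∷_)
open import Data.Product using (Σ; _×_; _,_; proj₁; proj₂)
open import Data.Sum using (_⊎_; inj₁; inj₂)
open import Data.Vec using (Vec; []; _∷_; lookup; toList; tail)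
open import Relation.Nullary using (¬_; contradiction)
open import Relation.Binary.PropositionalEquality

-- A computable stack machine evaluates codes; run for s steps with the stage-s
-- approximation of ∅′ as its oracle, it approximates in the limit every row
-- A = { b | φ e (e , b) = 1 } of a ∅′-computable sequence of sets.  The colour
-- f_e(s) is chosen so that, for the largest N ≤ s such that the stage-s
-- approximation of A ∩ [0, N) misses some colour, f_e(s) is a missed colour.
-- If A were thin for f_e, then for every N each sufficiently late s ∈ A would
-- have a colour that does not occur on A ∩ [0, N), because A ∩ [0, N) has been
-- approximated correctly by then; an infinite A would show infinitely many colours.

-- Closure properties of the functions computable without oracle

record Computable {n : ℕ} (f : Vec ℕ n → ℕ) : Set where
  constructor mk
  field
    code     : Code
    computes : ∀ v → Eval ∅ code (toList v) (f v)
open Computable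

infixr 5 _∷_
data Computables {n : ℕ} : {m : ℕ} → (Vec ℕ n → Vec ℕ m) → Set where
  []  : Computables (λ _ → [])
  _∷_ : ∀ {m f} {gs : Vec ℕ n → Vec ℕ m} →
        Computable f → Computables gs → Computables (λ v → f v ∷ gs v)

private variable
  n : ℕ
  f g h f₃ f₄ : Vec ℕ n → ℕ

ext : (∀ v → f v ≡ g v) → Computable f → Computable g
ext eq (mk c ok) = mk c λ v → subst (Eval ∅ c (toList v)) (eq v) (ok v)

nth-lookup : (v : Vec ℕ n) (i : Fin n) → nth (toℕ i) (toList v) ≡ lookup v i
nth-lookup (x ∷ v) zero    = refl
nth-lookup (x ∷ v) (suc i) = nth-lookup v i

var : (i : Fin n) → Computable (λ v → lookup v i)
var i = ext (λ v → nth-lookup v i) (mk (proj (toℕ i)) λ v → e-proj)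

projs : ℕ → ℕ → List Code
projs zero    i = []
projs (suc n) i = proj i ∷ projs n (suc i)

-- The number `i` counts skipped arguments: `projs n 0` copies the whole argument list, `projs n 2`
-- drops its first two entries.
projs-eval : ∀ i xs (v : Vec ℕ n) → (∀ j → nth (i + j) xs ≡ nth j (toList v)) →
             EvalAll ∅ (projs n i) xs (toList v)
projs-eval i xs []      eq = []
projs-eval i xs (x ∷ v) eq =
  subst (Eval ∅ (proj i) xs) (trans (cong (λ j → nth j xs) (sym (+-identityʳ i))) (eq 0)) e-proj
  ∷ projs-eval (suc i) xs v λ j → trans (cong (λ j → nth j xs) (sym (+-suc i j))) (eq (suc j))

-- Inside the step of a recursion the counter and the previous value stand in front of the
-- parameters; `wk` carries a function of the parameters there.
wk : Computable f → Computable {suc (suc n)} (λ v → f (tail (tail v)))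
wk {n = n} (mk c ok) = mk (comp c (projs n 2)) λ where
  (x ∷ y ∷ v) → e-comp (projs-eval 2 (x ∷ y ∷ toList v) v λ _ → refl) (ok v)

zeroᶜ : Computable {n} (λ _ → 0)
zeroᶜ = mk zer λ v → e-zer

sucᶜ : Computable f → Computable (λ v → suc (f v))
sucᶜ (mk c ok) = mk (comp sc (c ∷ [])) λ v → e-comp (ok v ∷ []) e-sc

lit : ∀ m → Computable {n} (λ _ → m)
lit zero    = zeroᶜ
lit (suc m) = sucᶜ (lit m)

natrec : ℕ → (ℕ → ℕ → ℕ) → ℕ → ℕ
natrec z s zero    = z
natrec z s (suc m) = s m (natrec z s m)

natrecᶜ : {s : Vec ℕ (suc (suc n)) → ℕ} → Computable f → Computable s → Computable g →
          Computable (λ v → natrec (f v) (λ m r → s (m ∷ r ∷ v)) (g v))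
natrecᶜ {n = n} {f = f} {s = s} (mk cf okf) (mk cs oks) (mk cg okg) =
  -- `prec` recurses on its first argument, so the value of `g` is put in front of a copy of the
  -- parameters.
  mk (comp (prec cf cs) (cg ∷ projs n 0))
     λ v → e-comp (okg v ∷ projs-eval 0 (toList v) v λ _ → refl) (go v _)
  where
  go : ∀ v m → Eval ∅ (prec cf cs) (m ∷ toList v) (natrec (f v) (λ m r → s (m ∷ r ∷ v)) m)
  go v zero    = e-prec0 (okf v)
  go v (suc m) = e-precS (go v m) (oks (m ∷ _ ∷ v))

pattern v₀ = zero
pattern v₁ = suc zero

predᶜ : Computable f → Computable (λ v → pred (f v))
predᶜ {f = f} c = ext (λ v → eq (f v)) (natrecᶜ zeroᶜ (var v₀) c)
  where
  eq : ∀ m → natrec 0 (λ m _ → m) m ≡ pred m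
  eq zero    = refl
  eq (suc m) = refl

infixl 6 _+ᶜ_ _∸ᶜ_
_+ᶜ_ : Computable f → Computable g → Computable (λ v → f v + g v)
_+ᶜ_ {f = f} {g = g} c d = ext (λ v → eq (f v) (g v)) (natrecᶜ d (sucᶜ (var v₁)) c)
  where
  eq : ∀ m n → natrec n (λ _ → suc) m ≡ m + n
  eq zero    n = refl
  eq (suc m) n = cong suc (eq m n)

_∸ᶜ_ : Computable f → Computable g → Computable (λ v → f v ∸ g v)
_∸ᶜ_ {f = f} {g = g} c d = ext (λ v → eq (f v) (g v)) (natrecᶜ c (predᶜ (var v₁)) d)
  where
  eq : ∀ m n → natrec m (λ _ → pred) n ≡ m ∸ n
  eq m zero    = refl
  eq m (suc n) = trans (cong pred (eq m n)) (pred[m∸n]≡m∸[1+n] m n)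

ifz : ℕ → ℕ → ℕ → ℕ
ifz zero    a b = a
ifz (suc _) a b = b

-- A zero test is a recursion whose step ignores both the counter and the previous value.
ifzᶜ : Computable f → Computable g → Computable h → Computable (λ v → ifz (f v) (g v) (h v))
ifzᶜ {f = f} {g = g} {h = h} c d e =
  ext (λ v → eq (f v) (g v) (h v)) (natrecᶜ d (wk e) c)
  where
  eq : ∀ m a b → natrec a (λ _ _ → b) m ≡ ifz m a b
  eq zero    a b = refl
  eq (suc m) a b = refl

nthᶜ : ∀ {m} {gs : Vec ℕ n → Vec ℕ m} → Computable f → Computables gs →
       Computable (λ v → nth (f v) (toList (gs v)))
nthᶜ             c []       = zeroᶜ
nthᶜ {f = f} c (_∷_ {f = g} {gs = gs} d ds) =
  ext (λ v → eq (f v) (g v) (toList (gs v))) (ifzᶜ c d (nthᶜ (predᶜ c) ds))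
  where
  eq : ∀ m x xs → ifz m x (nth (pred m) xs) ≡ nth m (x ∷ xs)
  eq zero    x xs = refl
  eq (suc m) x xs = refl

-- The distance |m - n|, which vanishes exactly at equality and so turns `ifz` into an equality
-- test.
dist : ℕ → ℕ → ℕ
dist m n = (m ∸ n) + (n ∸ m)

dist≡0⇒≡ : ∀ m n → dist m n ≡ 0 → m ≡ n
dist≡0⇒≡ m n eq = ≤-antisym (m∸n≡0⇒m≤n (m+n≡0⇒m≡0 _ eq)) (m∸n≡0⇒m≤n (m+n≡0⇒n≡0 (m ∸ n) eq))

dist-refl : ∀ m → dist m m ≡ 0
dist-refl m rewrite n∸n≡0 m = refl

distᶜ : Computable f → Computable g → Computable (λ v → dist (f v) (g v))
distᶜ c d = c ∸ᶜ d +ᶜ (d ∸ᶜ c)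

-- The Cantor pairing and its computable inverse

tri : ℕ → ℕ
tri = natrec 0 (λ m r → suc (m + r))

triᶜ : Computable f → Computable (λ v → tri (f v))
triᶜ = natrecᶜ zeroᶜ (sucᶜ (var v₀ +ᶜ var v₁))

n≤tri : ∀ n → n ≤ tri n
n≤tri zero    = z≤n
n≤tri (suc n) = s≤s (m≤m+n n _)

opaque
  pair : ℕ → ℕ → ℕ
  pair a b = tri (a + b) + b

  pairᶜ : Computable f → Computable g → Computable (λ v → pair (f v) (g v))
  pairᶜ c d = triᶜ (c +ᶜ d) +ᶜ d

  -- This equation and the next mirror the two clauses of `unpair`: passing to a new antidiagonal,
  -- and moving along one.
  pair-zero : ∀ b → pair (suc b) 0 ≡ suc (pair 0 b)
  pair-zero b rewrite +-identityʳ b | +-identityʳ (b + tri b) = cong suc (+-comm b (tri b))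

  pair-suc : ∀ a b → pair a (suc b) ≡ suc (pair (suc a) b)
  pair-suc a b rewrite +-suc a b = +-suc _ b

  pair-unpair : ∀ n → pair (fstU n) (sndU n) ≡ n
  pair-unpair zero = refl
  pair-unpair (suc n) with unpair n | pair-unpair n
  ... | zero  , b | ih = trans (pair-zero b) (cong suc ih)
  ... | suc a , b | ih = trans (pair-suc a b) (cong suc ih)

  m+n≤pair : ∀ a b → a + b ≤ pair a b
  m+n≤pair a b = ≤-trans (n≤tri (a + b)) (m≤m+n _ b)

  sndU-eq : ∀ n → n ∸ tri (fstU n + sndU n) ≡ sndU n
  sndU-eq n = trans (cong (_∸ tri (fstU n + sndU n)) (sym (pair-unpair n)))
                    (m+n∸m≡n (tri (fstU n + sndU n)) (sndU n))

unpair-pair : ∀ a b → unpair (pair a b) ≡ (a , b)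
unpair-pair a b = go (a + b) a b refl
  where
  go : ∀ d a b → a + b ≡ d → unpair (pair a b) ≡ (a , b)
  -- The walk of `unpair` is traced backwards: `b` decreases along an antidiagonal, and `d`
  -- decreases once its start is reached.
  go d       a (suc b) eq rewrite pair-suc a b | go d (suc a) b (trans (sym (+-suc a b)) eq) = refl
  go (suc d) (suc a) zero eq rewrite pair-zero a | go d 0 a (trans (sym (+-identityʳ a)) (suc-injective eq)) = refl
  go d zero zero eq = unpair-pair₀
    where
    opaque
      unfolding pair
      unpair-pair₀ : unpair (pair 0 0) ≡ (0 , 0)
      unpair-pair₀ = refl

fstU-pair : ∀ a b → fstU (pair a b) ≡ a
fstU-pair a b = cong proj₁ (unpair-pair a b)

sndU-pair : ∀ a b → sndU (pair a b) ≡ b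
sndU-pair a b = cong proj₂ (unpair-pair a b)

fstU≤ : ∀ n → fstU n ≤ n
fstU≤ n = subst (fstU n ≤_) (pair-unpair n) (≤-trans (m≤m+n _ _) (m+n≤pair (fstU n) (sndU n)))

sndU≤ : ∀ n → sndU n ≤ n
sndU≤ n = subst (sndU n ≤_) (pair-unpair n) (≤-trans (m≤n+m _ _) (m+n≤pair (fstU n) (sndU n)))

-- The antidiagonal on which a number lies. It grows by one exactly when the next number is the
-- triangular number that starts a new antidiagonal, so `pair` is inverted without a search.
diagonal : ℕ → ℕ
diagonal = natrec 0 (λ n d → ifz (dist (suc n) (tri (suc d))) (suc d) d)

opaque
  unfolding pair
  diagonal-eq : ∀ n → diagonal n ≡ fstU n + sndU n
  diagonal-eq zero = refl
  diagonal-eq (suc n) rewrite diagonal-eq n with unpair n | pair-unpair n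
  ... | zero  , b | refl
    rewrite +-comm b (tri b) | dist-refl (tri b + b) = cong suc (sym (+-identityʳ b))
  ... | suc a , b | refl with dist (tri (suc a + b) + b) (suc a + b + tri (suc a + b)) in eq
  ...   | suc _ = sym (+-suc a b)
  -- A new antidiagonal starting here would force `b` to equal `suc a + b`.
  ...   | zero with +-cancelʳ-≡ (tri (suc a + b)) b (suc a + b) (trans (+-comm b _) (dist≡0⇒≡ _ _ eq))
  ...     | p with m≢1+n+m b p
  ...       | ()

diagonalᶜ : Computable f → Computable (λ v → diagonal (f v))
diagonalᶜ = natrecᶜ zeroᶜ (ifzᶜ (distᶜ (sucᶜ (var v₀)) (triᶜ (sucᶜ (var v₁)))) (sucᶜ (var v₁)) (var v₁))

sndᶜ : Computable f → Computable (λ v → sndU (f v))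
sndᶜ {f = f} c =
  ext (λ v → trans (cong (λ d → f v ∸ tri d) (diagonal-eq (f v))) (sndU-eq (f v)))
      (c ∸ᶜ triᶜ (diagonalᶜ c))

fstᶜ : Computable f → Computable (λ v → fstU (f v))
fstᶜ {f = f} c =
  ext (λ v → trans (cong (_∸ sndU (f v)) (diagonal-eq (f v))) (m+n∸n≡m (fstU (f v)) (sndU (f v))))
      (diagonalᶜ c ∸ᶜ sndᶜ c)

-- Division by 7, the number of tags in the decoding

remainder : ℕ → ℕ
remainder = natrec 0 (λ _ r → ifz (dist r 6) 0 (suc r))

quotient : ℕ → ℕ
quotient = natrec 0 (λ n q → ifz (dist (remainder n) 6) (suc q) q)

remainderᶜ : Computable f → Computable (λ v → remainder (f v))
remainderᶜ = natrecᶜ zeroᶜ (ifzᶜ (distᶜ (var v₁) (lit 6)) zeroᶜ (sucᶜ (var v₁)))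

quotientᶜ : Computable f → Computable (λ v → quotient (f v))
quotientᶜ = natrecᶜ zeroᶜ (ifzᶜ (distᶜ (remainderᶜ (var v₀)) (lit 6)) (sucᶜ (var v₁)) (var v₁))

rem-quot : ∀ n → remainder n < 7 × n ≡ remainder n + quotient n * 7
rem-quot zero = s≤s z≤n , refl
rem-quot (suc n) with remainder n | rem-quot n
... | r | r<7 , eq with dist r 6 in d
...   | zero  = s≤s z≤n , cong suc (trans eq (cong (_+ quotient n * 7) (dist≡0⇒≡ r 6 d)))
...   | suc _ = ≤∧≢⇒< r<7 (λ { refl → 0≢1+n d }) , cong suc eq

%-unique : ∀ r q → r < 7 → (r + q * 7) % 7 ≡ r
%-unique r q r<7 = trans ([m+kn]%n≡m%n r q 7) (m<n⇒m%n≡m r<7)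

/-unique : ∀ r q → r < 7 → (r + q * 7) / 7 ≡ q
/-unique r q r<7 = *-cancelʳ-≡ _ _ 7 (+-cancelˡ-≡ r _ _ (sym (trans (m≡m%n+[m/n]*n (r + q * 7) 7)
  (cong (_+ (r + q * 7) / 7 * 7) (%-unique r q r<7)))))

%7ᶜ : Computable f → Computable (λ v → f v % 7)
%7ᶜ {f = f} c = ext (λ v → eq (f v)) (remainderᶜ c)
  where
  eq : ∀ n → remainder n ≡ n % 7
  eq n = let r<7 , p = rem-quot n in sym (trans (cong (_% 7) p) (%-unique _ (quotient n) r<7))

/7ᶜ : Computable f → Computable (λ v → f v / 7)
/7ᶜ {f = f} c = ext (λ v → eq (f v)) (quotientᶜ c)
  where
  eq : ∀ n → quotient n ≡ n / 7
  eq n = let r<7 , p = rem-quot n in sym (trans (cong (_/ 7) p) (/-unique _ (quotient n) r<7))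

-- Gödel numbering of codes

φs : ℕ → List Code
φs n = decodeListF (suc n) n

-- One layer of the decoding with the fuel removed; `φ-unfold` shows that it agrees with `φ`.
build : ℕ → ℕ → Code
build 0 m = zer
build 1 m = sc
build 2 m = proj m
build 3 m = comp (φ (fstU m)) (φs (sndU m))
build 4 m = prec (φ (fstU m)) (φ (sndU m))
build 5 m = mu (φ m)
build _ m = orc

-- Fuel above the index never runs out: the parts of a code `n` have indices at most `n / 7`, which
-- is below `n` for positive `n`, and those of a list `suc m` have indices at most `m`. Index 0 has
-- no parts.
decodeF-stable : ∀ F G n → n < F → n < G → decodeF F n ≡ decodeF G n
decodeListF-stable : ∀ F G n → n < F → n < G → decodeListF F n ≡ decodeListF G n

decodeF-stable (suc F) (suc G) zero p q = refl
decodeF-stable (suc F) (suc G) n@(suc _) (s≤s p) (s≤s q)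
  with n % 7 | n / 7 | m/n<m n 7 (s≤s (s≤s z≤n))
... | 0 | m | lt = refl
... | 1 | m | lt = refl
... | 2 | m | lt = refl
... | 3 | m | lt = cong₂ comp
  (decodeF-stable F G _ (≤-trans (s≤s (fstU≤ m)) (≤-trans lt p)) (≤-trans (s≤s (fstU≤ m)) (≤-trans lt q)))
  (decodeListF-stable F G _ (≤-trans (s≤s (sndU≤ m)) (≤-trans lt p)) (≤-trans (s≤s (sndU≤ m)) (≤-trans lt q)))
... | 4 | m | lt = cong₂ prec
  (decodeF-stable F G _ (≤-trans (s≤s (fstU≤ m)) (≤-trans lt p)) (≤-trans (s≤s (fstU≤ m)) (≤-trans lt q)))
  (decodeF-stable F G _ (≤-trans (s≤s (sndU≤ m)) (≤-trans lt p)) (≤-trans (s≤s (sndU≤ m)) (≤-trans lt q)))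
... | 5 | m | lt = cong mu (decodeF-stable F G m (≤-trans lt p) (≤-trans lt q))
... | suc (suc (suc (suc (suc (suc _))))) | m | lt = refl

decodeListF-stable (suc F) (suc G) zero p q = refl
decodeListF-stable (suc F) (suc G) (suc m) (s≤s p) (s≤s q) = cong₂ _∷_
  (decodeF-stable F G _ (≤-trans (s≤s (fstU≤ m)) p) (≤-trans (s≤s (fstU≤ m)) q))
  (decodeListF-stable F G _ (≤-trans (s≤s (sndU≤ m)) p) (≤-trans (s≤s (sndU≤ m)) q))

φs-suc : ∀ m → φs (suc m) ≡ φ (fstU m) ∷ φs (sndU m)
φs-suc m = cong₂ _∷_ (decodeF-stable _ _ _ (s≤s (fstU≤ m)) ≤-refl)
                     (decodeListF-stable _ _ _ (s≤s (sndU≤ m)) ≤-refl)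

φ-unfold : ∀ n → φ n ≡ build (n % 7) (n / 7)
φ-unfold zero = refl
φ-unfold n@(suc _) with n % 7 | n / 7 | m/n<m n 7 (s≤s (s≤s z≤n))
... | 0 | m | lt = refl
... | 1 | m | lt = refl
... | 2 | m | lt = refl
... | 3 | m | lt = cong₂ comp (decodeF-stable _ _ _ (≤-trans (s≤s (fstU≤ m)) lt) ≤-refl)
                              (decodeListF-stable _ _ _ (≤-trans (s≤s (sndU≤ m)) lt) ≤-refl)
... | 4 | m | lt = cong₂ prec (decodeF-stable _ _ _ (≤-trans (s≤s (fstU≤ m)) lt) ≤-refl)
                              (decodeF-stable _ _ _ (≤-trans (s≤s (sndU≤ m)) lt) ≤-refl)
... | 5 | m | lt = cong mu (decodeF-stable _ _ _ lt ≤-refl)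
... | suc (suc (suc (suc (suc (suc _))))) | m | lt = refl

mutual
  encode : Code → ℕ
  encode zer         = 0
  encode sc          = 1
  encode (proj i)    = 2 + i * 7
  encode (comp f gs) = 3 + pair (encode f) (encodes gs) * 7
  encode (prec f g)  = 4 + pair (encode f) (encode g) * 7
  encode (mu f)      = 5 + encode f * 7
  encode orc         = 6

  encodes : List Code → ℕ
  encodes []       = 0
  encodes (g ∷ gs) = suc (pair (encode g) (encodes gs))

φ-build : ∀ t m → t < 7 → φ (t + m * 7) ≡ build t m
φ-build t m t<7 = trans (φ-unfold (t + m * 7)) (cong₂ build (%-unique t m t<7) (/-unique t m t<7))

mutual
  -- Every code has an index, which the final diagonalisation needs.
  φ-encode : ∀ c → φ (encode c) ≡ c
  φ-encode zer         = refl
  φ-encode sc          = refl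
  φ-encode (proj i)    = φ-build 2 i (m≤m+n 3 4)
  φ-encode (comp f gs) = trans (φ-build 3 (pair (encode f) (encodes gs)) (m≤m+n 4 3)) (cong₂ comp
    (trans (cong φ (fstU-pair _ (encodes gs))) (φ-encode f))
    (trans (cong φs (sndU-pair (encode f) _)) (φs-encodes gs)))
  φ-encode (prec f g)  = trans (φ-build 4 (pair (encode f) (encode g)) (m≤m+n 5 2)) (cong₂ prec
    (trans (cong φ (fstU-pair _ (encode g))) (φ-encode f))
    (trans (cong φ (sndU-pair (encode f) _)) (φ-encode g)))
  φ-encode (mu f)      = trans (φ-build 5 (encode f) (m≤m+n 6 1)) (cong mu (φ-encode f))
  φ-encode orc         = refl

  φs-encodes : ∀ gs → φs (encodes gs) ≡ gs
  φs-encodes []       = refl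
  φs-encodes (g ∷ gs) = trans (φs-suc _) (cong₂ _∷_
    (trans (cong φ (fstU-pair _ (encodes gs))) (φ-encode g))
    (trans (cong φs (sndU-pair (encode g) _)) (φs-encodes gs)))

-- Links the shape of `φ e` to the tag of `e`: derivations speak of codes, while the machine sees
-- only indices.
data View (e : ℕ) : Code → Set where
  vzer  : e % 7 ≡ 0 → View e zer
  vsc   : e % 7 ≡ 1 → View e sc
  vproj : e % 7 ≡ 2 → View e (proj (e / 7))
  vcomp : e % 7 ≡ 3 → View e (comp (φ (fstU (e / 7))) (φs (sndU (e / 7))))
  vprec : e % 7 ≡ 4 → View e (prec (φ (fstU (e / 7))) (φ (sndU (e / 7))))
  vmu   : e % 7 ≡ 5 → View e (mu (φ (e / 7)))
  vorc  : e % 7 ≡ 6 → View e orc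

view : ∀ e → View e (φ e)
view e = subst (View e) (sym (φ-unfold e)) (go (e % 7) refl (m%n<n e 7))
  where
  go : ∀ t → e % 7 ≡ t → t < 7 → View e (build t (e / 7))
  go 0 eq lt = vzer eq
  go 1 eq lt = vsc eq
  go 2 eq lt = vproj eq
  go 3 eq lt = vcomp eq
  go 4 eq lt = vprec eq
  go 5 eq lt = vmu eq
  go 6 eq lt = vorc eq
  go (suc (suc (suc (suc (suc (suc (suc _))))))) eq (s≤s (s≤s (s≤s (s≤s (s≤s (s≤s (s≤s ())))))))

data Views : ℕ → List Code → Set where
  []  : Views 0 []
  _∷_ : ∀ {m} → View (fstU m) (φ (fstU m)) → Views (sndU m) (φs (sndU m)) →
        Views (suc m) (φ (fstU m) ∷ φs (sndU m))

views : ∀ n → Views n (φs n)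
views n = go n n ≤-refl
  where
  -- The bound `N` carries the recursion, since `sndU m` is smaller than `suc m` without being a
  -- subterm of it.
  go : ∀ N n → n ≤ N → Views n (φs n)
  go N       zero    p       = []
  go (suc N) (suc m) (s≤s p) =
    subst (Views (suc m)) (sym (φs-suc m)) (view (fstU m) ∷ go N (sndU m) (≤-trans (sndU≤ m) p))

-- The machine

-- The coding that `decodeListF` reads, with 0 as the empty list; code lists, argument lists and
-- stacks all share it.
cons : ℕ → ℕ → ℕ
cons x l = suc (pair x l)

-- Both are 0 at the empty list because `unpair 0` is (0, 0), in agreement with the defaults of `hd`
-- and `nth`.
head# tail# : ℕ → ℕ
head# l = fstU (pred l)
tail# l = sndU (pred l)

nth# : ℕ → ℕ → ℕ
nth# m l = head# (natrec l (λ _ → tail#) m)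

consᶜ : Computable f → Computable g → Computable (λ v → cons (f v) (g v))
consᶜ c d = sucᶜ (pairᶜ c d)

headᶜ : Computable f → Computable (λ v → head# (f v))
headᶜ c = fstᶜ (predᶜ c)

tailᶜ : Computable f → Computable (λ v → tail# (f v))
tailᶜ c = sndᶜ (predᶜ c)

nth#ᶜ : Computable f → Computable g → Computable (λ v → nth# (f v) (g v))
nth#ᶜ c d = headᶜ (natrecᶜ d (tailᶜ (var v₁)) c)

natrec-shift : ∀ (s : ℕ → ℕ) z n → natrec z (λ _ → s) (suc n) ≡ natrec (s z) (λ _ → s) n
natrec-shift s z zero    = refl
natrec-shift s z (suc n) = cong s (natrec-shift s z n)

nth#-suc : ∀ m l → nth# (suc m) l ≡ nth# m (tail# l)
nth#-suc m l = cong head# (natrec-shift tail# l m)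

list : List ℕ → ℕ
list []       = 0
list (x ∷ xs) = cons x (list xs)

head-cons : ∀ x l → head# (cons x l) ≡ x
head-cons x l = fstU-pair x l

tail-cons : ∀ x l → tail# (cons x l) ≡ l
tail-cons x l = sndU-pair x l

head-list : ∀ xs → head# (list xs) ≡ hd xs
head-list []       = refl
head-list (x ∷ xs) = head-cons x (list xs)

nth-list : ∀ m xs → nth# m (list xs) ≡ nth m xs
nth-list zero    []       = refl
nth-list zero    (x ∷ xs) = head-cons x (list xs)
nth-list (suc m) []       = trans (nth#-suc m 0) (trans (nth-list m []) (nth-nil m))
  where
  nth-nil : ∀ m → nth m [] ≡ 0
  nth-nil zero    = refl
  nth-nil (suc m) = refl
nth-list (suc m) (x ∷ xs) =
  trans (nth#-suc m (cons x (list xs))) (trans (cong (nth# m) (tail-cons x (list xs))) (nth-list m xs))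

opaque
  -- Serves for machine states (mode, two data fields, stack) and for stack frames (tag, three data
  -- fields).
  quad : ℕ → ℕ → ℕ → ℕ → ℕ
  quad a b c d = pair a (pair b (pair c d))

  q₀ q₁ q₂ q₃ : ℕ → ℕ
  q₀ x = fstU x
  q₁ x = fstU (sndU x)
  q₂ x = fstU (sndU (sndU x))
  q₃ x = sndU (sndU (sndU x))

  q₀-quad : ∀ a b c d → q₀ (quad a b c d) ≡ a
  q₀-quad a b c d = fstU-pair a _

  q₁-quad : ∀ a b c d → q₁ (quad a b c d) ≡ b
  q₁-quad a b c d rewrite sndU-pair a (pair b (pair c d)) = fstU-pair b _

  q₂-quad : ∀ a b c d → q₂ (quad a b c d) ≡ c
  q₂-quad a b c d rewrite sndU-pair a (pair b (pair c d)) | sndU-pair b (pair c d) = fstU-pair c _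

  q₃-quad : ∀ a b c d → q₃ (quad a b c d) ≡ d
  q₃-quad a b c d rewrite sndU-pair a (pair b (pair c d)) | sndU-pair b (pair c d) = sndU-pair c _

  quadᶜ : Computable f → Computable g → Computable h → Computable f₃ →
          Computable (λ v → quad (f v) (g v) (h v) (f₃ v))
  quadᶜ a b c d = pairᶜ a (pairᶜ b (pairᶜ c d))

  q₀ᶜ : Computable f → Computable (λ v → q₀ (f v))
  q₀ᶜ = fstᶜ

  q₁ᶜ : Computable f → Computable (λ v → q₁ (f v))
  q₁ᶜ c = fstᶜ (sndᶜ c)

  q₂ᶜ : Computable f → Computable (λ v → q₂ (f v))
  q₂ᶜ c = fstᶜ (sndᶜ (sndᶜ c))

  q₃ᶜ : Computable f → Computable (λ v → q₃ (f v))
  q₃ᶜ c = sndᶜ (sndᶜ (sndᶜ c))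

-- Mode 0 hands a value to the stack `K`; modes 1 and 2 evaluate a code or a list of codes on top of
-- `K`.
ret : ℕ → ℕ → ℕ
ret y K = quad 0 y 0 K

ev evs : ℕ → ℕ → ℕ → ℕ
ev e xs K = quad 1 e xs K
evs gs xs K = quad 2 gs xs K

-- A frame says what awaits the next returned value. `compF` applies a code to it, `listF` evaluates
-- the remaining codes after it, `consF` prepends a stored value, `precF` runs the recursion step,
-- and `muF` tests a candidate.
compF consF : ℕ → ℕ
compF f = quad 0 f 0 0
consF y = quad 2 y 0 0

listF : ℕ → ℕ → ℕ
listF gs xs = quad 1 gs xs 0

precF muF : ℕ → ℕ → ℕ → ℕ
precF g m xs = quad 3 g m xs
muF f z xs = quad 4 f z xs

resume : ℕ → ℕ → ℕ → ℕ
resume F K a = nth (q₀ F)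
  ( ev (q₁ F) a K
  ∷ evs (q₁ F) (q₂ F) (cons (consF a) K)
  ∷ ret (cons (q₁ F) a) K
  ∷ ev (q₁ F) (cons (q₂ F) (cons a (q₃ F))) K
  -- Value 0 ends the search with the current candidate; any other value starts the next candidate.
  ∷ ifz a (ret (q₂ F) K)
          (ev (q₁ F) (cons (suc (q₂ F)) (q₃ F)) (cons (muF (q₁ F) (suc (q₂ F)) (q₃ F)) K))
  ∷ [])

retStep : ℕ → ℕ → ℕ
-- With an empty stack the state is a fixed point, so a halted machine keeps its output.
retStep a K = ifz K (ret a 0) (resume (head# K) (tail# K) a)

evBranches : (ℕ → ℕ) → ℕ → ℕ → ℕ → List ℕ
evBranches O e xs K =
    ret 0 K
  ∷ ret (suc (head# xs)) K
  ∷ ret (nth# (e / 7) xs) K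
  ∷ evs (sndU (e / 7)) xs (cons (compF (fstU (e / 7))) K)
  -- Primitive recursion has no value on an empty argument list, so the machine loops there.
  ∷ ifz xs (ev e xs K)
      (ifz (head# xs) (ev (fstU (e / 7)) (tail# xs) K)
        (ev e (cons (pred (head# xs)) (tail# xs))
          (cons (precF (sndU (e / 7)) (pred (head# xs)) (tail# xs)) K)))
  ∷ ev (e / 7) (cons 0 xs) (cons (muF (e / 7) 0 xs) K)
  ∷ ret (O (head# xs)) K
  ∷ []

evStep : (ℕ → ℕ) → ℕ → ℕ → ℕ → ℕ
evStep O e xs K = nth (e % 7) (evBranches O e xs K)

evsStep : ℕ → ℕ → ℕ → ℕ
evsStep gs xs K = ifz gs (ret 0 K) (ev (head# gs) xs (cons (listF (tail# gs) xs) K))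

step : (ℕ → ℕ) → ℕ → ℕ
step O σ = nth (q₀ σ)
  (retStep (q₁ σ) (q₃ σ) ∷ evStep O (q₁ σ) (q₂ σ) (q₃ σ) ∷ evsStep (q₁ σ) (q₂ σ) (q₃ σ) ∷ [])

run : (ℕ → ℕ) → ℕ → ℕ → ℕ
run O σ = natrec σ (λ _ → step O)

-- 0 while the machine runs, y + 1 once it has halted with value y.
output : ℕ → ℕ
output σ = ifz (q₀ σ) (ifz (q₃ σ) (suc (q₁ σ)) 0) 0

-- Computability of the machine

resumeᶜ : Computable f → Computable g → Computable h →
          Computable (λ v → resume (f v) (g v) (h v))
resumeᶜ F K a = nthᶜ (q₀ᶜ F)
  ( quadᶜ (lit 1) (q₁ᶜ F) a K
  ∷ quadᶜ (lit 2) (q₁ᶜ F) (q₂ᶜ F) (consᶜ (quadᶜ (lit 2) a (lit 0) (lit 0)) K)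
  ∷ quadᶜ (lit 0) (consᶜ (q₁ᶜ F) a) (lit 0) K
  ∷ quadᶜ (lit 1) (q₁ᶜ F) (consᶜ (q₂ᶜ F) (consᶜ a (q₃ᶜ F))) K
  ∷ ifzᶜ a (quadᶜ (lit 0) (q₂ᶜ F) (lit 0) K)
      (quadᶜ (lit 1) (q₁ᶜ F) (consᶜ (sucᶜ (q₂ᶜ F)) (q₃ᶜ F))
        (consᶜ (quadᶜ (lit 4) (q₁ᶜ F) (sucᶜ (q₂ᶜ F)) (q₃ᶜ F)) K))
  ∷ [])

retStepᶜ : Computable f → Computable g → Computable (λ v → retStep (f v) (g v))
retStepᶜ a K = ifzᶜ K (quadᶜ (lit 0) a (lit 0) (lit 0)) (resumeᶜ (headᶜ K) (tailᶜ K) a)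

-- For oracles that vary with a stage: the first argument is the stage, the second the query.
Computable₂ : (ℕ → ℕ → ℕ) → Set
Computable₂ O = ∀ {n} {f g : Vec ℕ n → ℕ} → Computable f → Computable g → Computable (λ v → O (f v) (g v))

module _ (O : ℕ → ℕ → ℕ) (Oᶜ : Computable₂ O) where

  evStepᶜ : Computable f → Computable g → Computable h → Computable f₃ →
            Computable (λ v → evStep (O (f v)) (g v) (h v) (f₃ v))
  evStepᶜ s e xs K = nthᶜ (%7ᶜ e)
    ( quadᶜ (lit 0) (lit 0) (lit 0) K
    ∷ quadᶜ (lit 0) (sucᶜ (headᶜ xs)) (lit 0) K
    ∷ quadᶜ (lit 0) (nth#ᶜ (/7ᶜ e) xs) (lit 0) K
    ∷ quadᶜ (lit 2) (sndᶜ (/7ᶜ e)) xs (consᶜ (quadᶜ (lit 0) (fstᶜ (/7ᶜ e)) (lit 0) (lit 0)) K)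
    ∷ ifzᶜ xs (quadᶜ (lit 1) e xs K)
        (ifzᶜ (headᶜ xs) (quadᶜ (lit 1) (fstᶜ (/7ᶜ e)) (tailᶜ xs) K)
          (quadᶜ (lit 1) e (consᶜ (predᶜ (headᶜ xs)) (tailᶜ xs))
            (consᶜ (quadᶜ (lit 3) (sndᶜ (/7ᶜ e)) (predᶜ (headᶜ xs)) (tailᶜ xs)) K)))
    ∷ quadᶜ (lit 1) (/7ᶜ e) (consᶜ (lit 0) xs) (consᶜ (quadᶜ (lit 4) (/7ᶜ e) (lit 0) xs) K)
    ∷ quadᶜ (lit 0) (Oᶜ s (headᶜ xs)) (lit 0) K
    ∷ [])

  evsStepᶜ : Computable f → Computable g → Computable h →
             Computable (λ v → evsStep (f v) (g v) (h v))
  evsStepᶜ gs xs K = ifzᶜ gs (quadᶜ (lit 0) (lit 0) (lit 0) K)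
    (quadᶜ (lit 1) (headᶜ gs) xs (consᶜ (quadᶜ (lit 1) (tailᶜ gs) xs (lit 0)) K))

  stepᶜ : Computable f → Computable g → Computable (λ v → step (O (f v)) (g v))
  stepᶜ s σ = nthᶜ (q₀ᶜ σ)
    (retStepᶜ (q₁ᶜ σ) (q₃ᶜ σ) ∷ evStepᶜ s (q₁ᶜ σ) (q₂ᶜ σ) (q₃ᶜ σ) ∷ evsStepᶜ (q₁ᶜ σ) (q₂ᶜ σ) (q₃ᶜ σ) ∷ [])

  runᶜ : Computable f → Computable g → Computable h → Computable (λ v → run (O (f v)) (g v) (h v))
  runᶜ s σ t = natrecᶜ σ (stepᶜ (wk s) (var v₁)) t

outputᶜ : Computable f → Computable (λ v → output (f v))
outputᶜ σ = ifzᶜ (q₀ᶜ σ) (ifzᶜ (q₃ᶜ σ) (sucᶜ (q₁ᶜ σ)) zeroᶜ) zeroᶜ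

-- Completeness of the machine

step-quad : ∀ O m a b K →
  step O (quad m a b K) ≡ nth m (retStep a K ∷ evStep O a b K ∷ evsStep a b K ∷ [])
step-quad O m a b K
  rewrite q₀-quad m a b K | q₁-quad m a b K | q₂-quad m a b K | q₃-quad m a b K = refl

resume-quad : ∀ t a b c K y → resume (quad t a b c) K y ≡ nth t
  ( ev a y K
  ∷ evs a b (cons (consF y) K)
  ∷ ret (cons a y) K
  ∷ ev a (cons b (cons y c)) K
  ∷ ifz y (ret b K) (ev a (cons (suc b) c) (cons (muF a (suc b) c) K))
  ∷ [])
resume-quad t a b c K y
  rewrite q₀-quad t a b c | q₁-quad t a b c | q₂-quad t a b c | q₃-quad t a b c = refl

step-halted : ∀ O y → step O (ret y 0) ≡ ret y 0
step-halted O y = step-quad O 0 y 0 0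

step-ret : ∀ O y t a b c K → step O (ret y (cons (quad t a b c) K)) ≡ nth t
  ( ev a y K
  ∷ evs a b (cons (consF y) K)
  ∷ ret (cons a y) K
  ∷ ev a (cons b (cons y c)) K
  ∷ ifz y (ret b K) (ev a (cons (suc b) c) (cons (muF a (suc b) c) K))
  ∷ [])
step-ret O y t a b c K = trans (step-quad O 0 y 0 (cons F K))
  (trans (cong₂ (λ F K → resume F K y) (head-cons F K) (tail-cons F K)) (resume-quad t a b c K y))
  where F = quad t a b c

module _ (O : ℕ → ℕ) {e : ℕ} (xs K : ℕ) where

  step-ev : ∀ {t} → e % 7 ≡ t → step O (ev e xs K) ≡ nth t (evBranches O e xs K)
  step-ev eq = trans (step-quad O 1 e xs K) (cong (λ t → nth t (evBranches O e xs K)) eq)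

  step-zer : e % 7 ≡ 0 → step O (ev e xs K) ≡ ret 0 K
  step-zer = step-ev

  step-sc : e % 7 ≡ 1 → step O (ev e xs K) ≡ ret (suc (head# xs)) K
  step-sc = step-ev

  step-proj : e % 7 ≡ 2 → step O (ev e xs K) ≡ ret (nth# (e / 7) xs) K
  step-proj = step-ev

  step-comp : e % 7 ≡ 3 →
    step O (ev e xs K) ≡ evs (sndU (e / 7)) xs (cons (compF (fstU (e / 7))) K)
  step-comp = step-ev

  step-mu : e % 7 ≡ 5 →
    step O (ev e xs K) ≡ ev (e / 7) (cons 0 xs) (cons (muF (e / 7) 0 xs) K)
  step-mu = step-ev

  step-orc : e % 7 ≡ 6 → step O (ev e xs K) ≡ ret (O (head# xs)) K
  step-orc = step-ev

step-prec : ∀ O {e} n xs K → e % 7 ≡ 4 → step O (ev e (cons n xs) K) ≡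
  ifz n (ev (fstU (e / 7)) xs K) (ev e (cons (pred n) xs) (cons (precF (sndU (e / 7)) (pred n) xs) K))
step-prec O {e} n xs K eq = trans (step-ev O (cons n xs) K eq)
  (cong₂ (λ n xs → ifz n (ev (fstU (e / 7)) xs K)
                         (ev e (cons (pred n) xs) (cons (precF (sndU (e / 7)) (pred n) xs) K)))
         (head-cons n xs) (tail-cons n xs))

step-prec-[] : ∀ O {e} K → e % 7 ≡ 4 → step O (ev e 0 K) ≡ ev e 0 K
step-prec-[] O K = step-ev O 0 K

step-evs : ∀ O gs xs K → step O (evs gs xs K) ≡ evsStep gs xs K
step-evs O gs xs K = step-quad O 2 gs xs K

run-+ : ∀ O σ m n → run O (run O σ m) n ≡ run O σ (m + n)
run-+ O σ m zero    = cong (run O σ) (sym (+-identityʳ m))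
run-+ O σ m (suc n) = trans (cong (step O) (run-+ O σ m n)) (cong (run O σ) (sym (+-suc m n)))

run-halted : ∀ O y t → run O (ret y 0) t ≡ ret y 0
run-halted O y zero    = refl
run-halted O y (suc t) = trans (cong (step O) (run-halted O y t)) (step-halted O y)

output-ret : ∀ y → output (ret y 0) ≡ suc y
output-ret y rewrite q₀-quad 0 y 0 0 | q₃-quad 0 y 0 0 | q₁-quad 0 y 0 0 = refl

output-running : ∀ m a b K → output (quad (suc m) a b K) ≡ 0
output-running m a b K rewrite q₀-quad (suc m) a b K = refl

output-stacked : ∀ y F K → output (ret y (cons F K)) ≡ 0
output-stacked y F K rewrite q₀-quad 0 y 0 (cons F K) | q₃-quad 0 y 0 (cons F K) = refl

Eventually : (ℕ → Set) → Set
Eventually P = Σ ℕ λ s₀ → ∀ s → s₀ ≤ s → P s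

-- The use principle: a derivation asks only finitely many oracle questions, so from some stage on
-- all of them are answered correctly. Hence one number of steps serves all late stages.
module Completeness {X : ℕ → Set} (O : ℕ → ℕ → ℕ)
  (yes : ∀ x → X x → Eventually λ s → O s x ≡ 1)
  (no  : ∀ x → ¬ X x → Eventually λ s → O s x ≡ 0) where

  infix 4 _⟶_
  _⟶_ : ℕ → ℕ → Set
  σ ⟶ τ = Σ ℕ λ t → Eventually λ s → run (O s) σ t ≡ τ

  step⟶ : ∀ {σ τ} → (∀ s → step (O s) σ ≡ τ) → σ ⟶ τ
  step⟶ eq = 1 , 0 , λ s _ → eq s

  infixr 4 _⨾_
  _⨾_ : ∀ {σ τ υ} → σ ⟶ τ → τ ⟶ υ → σ ⟶ υ
  _⨾_ {σ} (t , s₀ , p) (u , s₁ , q) = t + u , s₀ ⊔ s₁ , λ s le →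
    trans (sym (run-+ (O s) σ t u))
      (trans (cong (λ τ → run (O s) τ u) (p s (m⊔n≤o⇒m≤o s₀ s₁ le))) (q s (m⊔n≤o⇒n≤o s₀ s₁ le)))

  step-cong : ∀ {σ y} → (∀ s → step (O s) σ ≡ y) → ∀ {y′} → y ≡ y′ → σ ⟶ y′
  step-cong p refl = step⟶ p

  -- Induction on the derivation. The stack is arbitrary because subevaluations run below new
  -- frames.
  complete : ∀ {c xs y e} → Eval X c xs y → View e c → ∀ K → ev e (list xs) K ⟶ ret y K
  completes : ∀ {cs xs ys gs} → EvalAll X cs xs ys → Views gs cs → ∀ K →
              evs gs (list xs) K ⟶ ret (list ys) K

  complete {xs = xs} e-zer (vzer t) K = step⟶ λ s → step-zer (O s) (list xs) K t
  complete {xs = xs} e-sc (vsc t) K =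
    step-cong (λ s → step-sc (O s) (list xs) K t) (cong (λ x → ret (suc x) K) (head-list xs))
  complete {xs = xs} {e = e} e-proj (vproj t) K =
    step-cong (λ s → step-proj (O s) (list xs) K t) (cong (λ x → ret x K) (nth-list (e / 7) xs))
  complete {xs = xs} {e = e} (e-comp {ys = ys} ds d) (vcomp t) K =
    step⟶ (λ s → step-comp (O s) (list xs) K t)
    ⨾ completes ds (views (sndU (e / 7))) _
    ⨾ step⟶ (λ s → step-ret (O s) (list ys) 0 (fstU (e / 7)) 0 0 K)
    ⨾ complete d (view (fstU (e / 7))) K
  complete {e = e} (e-prec0 {xs = xs} d) (vprec t) K =
    step⟶ (λ s → step-prec (O s) 0 (list xs) K t)
    ⨾ complete d (view (fstU (e / 7))) K
  complete {e = e} (e-precS {n = n} {xs = xs} {r = r} d d′) (vprec t) K =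
    step⟶ (λ s → step-prec (O s) (suc n) (list xs) K t)
    ⨾ complete d (vprec t) _
    ⨾ step⟶ (λ s → step-ret (O s) r 3 (sndU (e / 7)) n (list xs) K)
    ⨾ complete d′ (view (sndU (e / 7))) K
  complete {xs = xs} {e = e} (e-mu {y = y} d below) (vmu t) K =
    step⟶ (λ s → step-mu (O s) (list xs) K t)
    ⨾ search y ≤-refl
    ⨾ complete d (view body) _
    ⨾ step⟶ (λ s → step-ret (O s) 0 4 body y (list xs) K)
    where
    body = e / 7
    -- Every candidate below `y` returns a positive value, which replaces the frame for `z` by the
    -- one for `suc z`.
    search : ∀ z → z ≤ y → ev body (cons 0 (list xs)) (cons (muF body 0 (list xs)) K)
                         ⟶ ev body (cons z (list xs)) (cons (muF body z (list xs)) K)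
    search zero    le = 0 , 0 , λ _ _ → refl
    search (suc z) le with below z le
    ... | v , dz = search z (<⇒≤ le)
      ⨾ complete dz (view body) _
      ⨾ step⟶ (λ s → step-ret (O s) (suc v) 4 body z (list xs) K)
  complete {xs = xs} (e-orc1 x∈X) (vorc t) K with yes _ x∈X
  ... | s₀ , p = 1 , s₀ , λ s le → trans (step-orc (O s) (list xs) K t)
    (cong (λ x → ret x K) (trans (cong (O s) (head-list xs)) (p s le)))
  complete {xs = xs} (e-orc0 x∉X) (vorc t) K with no _ x∉X
  ... | s₀ , p = 1 , s₀ , λ s le → trans (step-orc (O s) (list xs) K t)
    (cong (λ x → ret x K) (trans (cong (O s) (head-list xs)) (p s le)))

  completes {xs = xs} [] [] K = step⟶ λ s → step-evs (O s) 0 (list xs) K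
  completes {xs = xs} (_∷_ {y = y} {ys = ys} d ds) (_∷_ {m} w ws) K =
    step⟶ (λ s → step-evs (O s) (suc m) (list xs) K)
    ⨾ complete d w _
    ⨾ step⟶ (λ s → step-ret (O s) y 1 (sndU m) (list xs) 0 K)
    ⨾ completes ds ws _
    ⨾ step⟶ (λ s → step-ret (O s) (list ys) 2 y 0 0 K)

  -- The stage doubles as the running time: once it exceeds both the time `t` and the threshold
  -- `s₀`, the machine has halted with the right value and stays there.
  output-limit : ∀ e xs {y} → Eval X (φ e) xs y →
                 Eventually λ s → output (run (O s) (ev e (list xs) 0) s) ≡ suc y
  output-limit e xs {y} d with complete d (view e) 0
  ... | t , s₀ , p = t ⊔ s₀ , λ s le → trans (cong output (begin
    run (O s) (ev e (list xs) 0) s                     ≡⟨ cong (run (O s) _) (m+[n∸m]≡n (m⊔n≤o⇒m≤o t s₀ le)) ⟨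
    run (O s) (ev e (list xs) 0) (t + (s ∸ t))         ≡⟨ run-+ (O s) _ t (s ∸ t) ⟨
    run (O s) (run (O s) (ev e (list xs) 0) t) (s ∸ t) ≡⟨ cong (λ σ → run (O s) σ (s ∸ t)) (p s (m⊔n≤o⇒n≤o t s₀ le)) ⟩
    run (O s) (ret y 0) (s ∸ t)                        ≡⟨ run-halted (O s) y (s ∸ t) ⟩
    ret y 0                                            ∎)) (output-ret y)
    where open ≡-Reasoning

-- Soundness of the machine without oracle, and the jump

module Soundness where

  O : ℕ → ℕ
  O _ = 0

  opaque
    Halts : ℕ → ℕ → Set
    Halts t σ = output (run O σ t) ≢ 0

    output⇒Halts : ∀ t {σ y} → output (run O σ t) ≡ suc y → Halts t σ
    output⇒Halts t eq z = 1+n≢0 (trans (sym eq) z)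

    halts-step : ∀ t {σ τ} → step O σ ≡ τ → Halts (suc t) σ → Halts t τ
    halts-step t {σ} refl h = subst (λ σ → output σ ≢ 0) (natrec-shift (step O) σ t) h

    output-step : ∀ σ → output σ ≢ 0 → output (step O σ) ≢ 0
    output-step σ h with q₀ σ | q₃ σ
    ... | suc _ | _     = contradiction refl h
    ... | zero  | suc _ = contradiction refl h
    ... | zero  | zero  = λ eq → 1+n≢0 (trans (sym (output-ret (q₁ σ))) eq)

    halts-suc : ∀ t {σ} → Halts t σ → Halts (suc t) σ
    halts-suc t {σ} = output-step (run O σ t)

    ev-running : ∀ {e xs K} → ¬ Halts 0 (ev e xs K)
    ev-running {e} {xs} {K} h = h (output-running 0 e xs K)

    evs-running : ∀ {gs xs K} → ¬ Halts 0 (evs gs xs K)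
    evs-running {gs} {xs} {K} h = h (output-running 1 gs xs K)

    ret-running : ∀ {y F K} → ¬ Halts 0 (ret y (cons F K))
    ret-running {y} {F} {K} h = h (output-stacked y F K)

  -- A halting run must empty its stack, so the evaluation has to return to `K` first. The induction
  -- is on the time `t`: each machine step lowers it, and a call hands back a state that still halts
  -- within its own bound, which permits nested calls.
  sound : ∀ t {e c} → View e c → ∀ xs K → Halts t (ev e (list xs) K) →
          Σ ℕ λ y → Eval ∅ c xs y × Halts t (ret y K)
  sounds : ∀ t {gs cs} → Views gs cs → ∀ xs K → Halts t (evs gs (list xs) K) →
           Σ (List ℕ) λ ys → EvalAll ∅ cs xs ys × Halts t (ret (list ys) K)
  -- The hypothesis on smaller candidates accumulates the positive values that `e-mu` demands.
  search : ∀ t f xs z K → (∀ z′ → z′ < z → Σ ℕ λ v → Eval ∅ (φ f) (z′ ∷ xs) (suc v)) →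
           Halts t (ev f (list (z ∷ xs)) (cons (muF f z (list xs)) K)) →
           Σ ℕ λ y → Eval ∅ (mu (φ f)) xs y × Halts t (ret y K)

  sound zero v xs K h = contradiction h ev-running
  sound (suc t) (vzer eq) xs K h = 0 , e-zer , halts-suc t (halts-step t (step-zer O (list xs) K eq) h)
  sound (suc t) (vsc eq) xs K h = _ , e-sc ,
    halts-suc t (halts-step t (trans (step-sc O (list xs) K eq) (cong (λ x → ret (suc x) K) (head-list xs))) h)
  sound (suc t) {e} (vproj eq) xs K h = _ , e-proj ,
    halts-suc t (halts-step t (trans (step-proj O (list xs) K eq) (cong (λ x → ret x K) (nth-list (e / 7) xs))) h)
  sound (suc t) {e} (vcomp eq) xs K h
    with sounds t (views (sndU (e / 7))) xs _ (halts-step t (step-comp O (list xs) K eq) h)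
  -- A value with a frame still waiting is not halted, so some time must remain.
  sound (suc zero) (vcomp eq) xs K h | ys , ds , h′ = contradiction h′ ret-running
  sound (suc (suc t)) {e} (vcomp eq) xs K h | ys , ds , h′
    with sound t (view (fstU (e / 7))) ys K (halts-step t (step-ret O (list ys) 0 (fstU (e / 7)) 0 0 K) h′)
  ... | y , d , h″ = y , e-comp ds d , halts-suc (suc t) (halts-suc t h″)
  -- The machine loops in this state, so the call merely counts `t` down to the contradiction at 0.
  sound (suc t) (vprec eq) [] K h with sound t (vprec eq) [] K (halts-step t (step-prec-[] O K eq) h)
  ... | y , d , h′ = y , d , halts-suc t h′
  sound (suc t) {e} (vprec eq) (zero ∷ xs) K h
    with sound t (view (fstU (e / 7))) xs K (halts-step t (step-prec O 0 (list xs) K eq) h)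
  ... | y , d , h′ = y , e-prec0 d , halts-suc t h′
  sound (suc t) (vprec eq) (suc n ∷ xs) K h
    with sound t (vprec eq) (n ∷ xs) _ (halts-step t (step-prec O (suc n) (list xs) K eq) h)
  sound (suc zero) (vprec eq) (suc n ∷ xs) K h | r , d , h′ = contradiction h′ ret-running
  sound (suc (suc t)) {e} (vprec eq) (suc n ∷ xs) K h | r , d , h′
    with sound t (view (sndU (e / 7))) (n ∷ r ∷ xs) K
               (halts-step t (step-ret O r 3 (sndU (e / 7)) n (list xs) K) h′)
  ... | y , d′ , h″ = y , e-precS d d′ , halts-suc (suc t) (halts-suc t h″)
  sound (suc t) {e} (vmu eq) xs K h
    with search t (e / 7) xs 0 K (λ _ ()) (halts-step t (step-mu O (list xs) K eq) h)
  ... | y , d , h′ = y , d , halts-suc t h′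
  sound (suc t) (vorc eq) xs K h = 0 , e-orc0 (λ ()) , halts-suc t (halts-step t (step-orc O (list xs) K eq) h)

  sounds zero v xs K h = contradiction h evs-running
  sounds (suc t) [] xs K h = [] , [] , halts-suc t (halts-step t (step-evs O 0 (list xs) K) h)
  sounds (suc t) (_∷_ {m} v vs) xs K h with sound t v xs _ (halts-step t (step-evs O (suc m) (list xs) K) h)
  sounds (suc zero) (v ∷ vs) xs K h | y , d , h′ = contradiction h′ ret-running
  sounds (suc (suc t)) (_∷_ {m} v vs) xs K h | y , d , h′
    with sounds t vs xs _ (halts-step t (step-ret O y 1 (sndU m) (list xs) 0 K) h′)
  sounds (suc (suc zero)) (v ∷ vs) xs K h | y , d , h′ | ys , ds , h″ = contradiction h″ ret-running
  sounds (suc (suc (suc t))) (v ∷ vs) xs K h | y , d , h′ | ys , ds , h″ = y ∷ ys , d ∷ ds ,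
    halts-suc (suc (suc t)) (halts-suc (suc t) (halts-suc t (halts-step t (step-ret O (list ys) 2 y 0 0 K) h″)))

  search t f xs z K below h with sound t (view f) (z ∷ xs) _ h
  search zero f xs z K below h | y , d , h′ = contradiction h′ ret-running
  search (suc t) f xs z K below h | zero , d , h′ =
    z , e-mu d below , halts-suc t (halts-step t (step-ret O 0 4 f z (list xs) K) h′)
  search (suc t) f xs z K below h | suc v , d , h′
    with search t f xs (suc z) K below′ (halts-step t (step-ret O (suc v) 4 f z (list xs) K) h′)
    where
    below′ : ∀ z′ → z′ < suc z → Σ ℕ λ v → Eval ∅ (φ f) (z′ ∷ xs) (suc v)
    below′ z′ (s≤s le) with m≤n⇒m<n∨m≡n le
    ... | inj₁ lt   = below z′ lt
    ... | inj₂ refl = v , d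
  ... | y , d′ , h″ = y , d′ , halts-suc t h″

open Soundness using (sound; output⇒Halts)

jump : ℕ → ℕ → ℕ
jump s x = ifz (output (run (λ _ → 0) (ev x (list (x ∷ [])) 0) s)) 0 1

jumpᶜ : Computable₂ jump
jumpᶜ s x = ifzᶜ (outputᶜ (runᶜ (λ _ _ → 0) (λ _ _ → zeroᶜ) zeroᶜ (quadᶜ (lit 1) x (consᶜ x zeroᶜ) zeroᶜ) s)) zeroᶜ (lit 1)

jump-yes : ∀ x → ∅′ x → Eventually λ s → jump s x ≡ 1
jump-yes x (y , d) with Completeness.output-limit {X = ∅} (λ _ _ → 0) (λ _ ()) (λ _ _ → 0 , λ _ _ → refl) x (x ∷ []) d
... | s₀ , p = s₀ , λ s le → cong (λ o → ifz o 0 1) (p s le)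

-- Soundness enters here: a halting run would give a derivation and put `x` into `∅′`, so the
-- approximation is 0 at every stage.
jump-no : ∀ x → ¬ ∅′ x → Eventually λ s → jump s x ≡ 0
jump-no x x∉ = 0 , λ s _ → go s
  where
  go : ∀ s → jump s x ≡ 0
  go s with output (run (λ _ → 0) (ev x (list (x ∷ [])) 0) s) in eq
  ... | zero  = refl
  ... | suc _ with sound s (view x) (x ∷ []) 0 (output⇒Halts s eq)
  ...   | y , d , _ = contradiction (y , d) x∉

-- Approximated rows and colours missed on initial segments

opaque
  -- Stage-s approximation to the complement of row e of the e-th ∅′-computable
  -- sequence of sets: 0 means that b looks like an element.
  outside : ℕ → ℕ → ℕ → ℕ
  outside e s b = dist (output (run (jump s) (ev e (list (e ∷ b ∷ [])) 0) s)) 2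

  outsideᶜ : Computable f → Computable g → Computable h → Computable (λ v → outside (f v) (g v) (h v))
  outsideᶜ e s b =
    distᶜ (outputᶜ (runᶜ jump jumpᶜ s (quadᶜ (lit 1) e (consᶜ e (consᶜ b zeroᶜ)) zeroᶜ) s)) (lit 2)

  -- The machine outputs `suc a` for a value `a`, so membership, which is value 1, shows as 2.
  outside-limit : ∀ e b {a} → Eval ∅′ (φ e) (e ∷ b ∷ []) a →
                  Eventually λ s → outside e s b ≡ dist (suc a) 2
  outside-limit e b d with Completeness.output-limit jump jump-yes jump-no e (e ∷ b ∷ []) d
  ... | s₀ , p = s₀ , λ s le → cong (λ o → dist o 2) (p s le)

-- Finitely many thresholds have a maximum; this makes the approximation correct on a whole initial
-- segment at once.
eventually-below : ∀ {P : ℕ → ℕ → Set} → (∀ b → Eventually λ s → P s b) →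
                   ∀ N → Eventually λ s → ∀ b → b < N → P s b
eventually-below ev zero    = 0 , λ _ _ _ ()
eventually-below ev (suc N) with eventually-below ev N | ev N
... | s₀ , p | s₁ , q = s₀ ⊔ s₁ , λ s le b b≤N → go s le b (m≤n⇒m<n∨m≡n (≤-pred b≤N))
  where
  go : ∀ s → s₀ ⊔ s₁ ≤ s → ∀ b → b < N ⊎ b ≡ N → _
  go s le b (inj₁ b<N)  = p s (m⊔n≤o⇒m≤o s₀ s₁ le) b b<N
  go s le b (inj₂ refl) = q s (m⊔n≤o⇒n≤o s₀ s₁ le)

-- Zeros of `p` are the elements of the set, and `q` is the colouring.
Missing : (ℕ → ℕ) → (ℕ → ℕ) → ℕ → ℕ → Set
Missing p q N c = ∀ b → b < N → p b ≡ 0 → q b ≢ c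

Missing-antitone : ∀ {p q M N c} → M ≤ N → Missing p q N c → Missing p q M c
Missing-antitone M≤N mis b b<M = mis b (≤-trans b<M M≤N)

-- 0 if some b < N with p b ≡ 0 has q b ≡ c, and 1 otherwise.
missed : (ℕ → ℕ) → (ℕ → ℕ) → ℕ → ℕ → ℕ
missed p q N c = natrec 1 (λ b t → ifz (p b) (ifz (dist (q b) c) 0 t) t) N

missed⇒Missing : ∀ p q N c → missed p q N c ≢ 0 → Missing p q N c
missed⇒Missing p q (suc N) c ne b b≤N pb qb with m≤n⇒m<n∨m≡n (≤-pred b≤N)
... | inj₂ refl rewrite pb | qb | dist-refl c = ne refl
... | inj₁ b<N with p N | dist (q N) c
...   | suc _ | _     = missed⇒Missing p q N c ne b b<N pb qb
...   | zero  | suc _ = missed⇒Missing p q N c ne b b<N pb qb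
...   | zero  | zero  = ne refl

Missing⇒missed : ∀ p q N c → Missing p q N c → missed p q N c ≢ 0
Missing⇒missed p q zero c mis ()
Missing⇒missed p q (suc N) c mis
  with p N in eq | dist (q N) c in eq′ | Missing⇒missed p q N c (Missing-antitone (n≤1+n N) mis)
... | suc _ | _     | ih = ih
... | zero  | suc _ | ih = ih
... | zero  | zero  | ih = contradiction (dist≡0⇒≡ (q N) c eq′) (mis N ≤-refl eq)

-- The diagonal colouring

module Colouring (k : ℕ) where

  -- A colour below k missed on [0, N), or k if there is none.
  missing : (ℕ → ℕ) → (ℕ → ℕ) → ℕ → ℕ
  missing p q N = natrec k (λ c t → ifz (missed p q N c) t c) k

  missing-Missing : ∀ p q N → missing p q N < k → Missing p q N (missing p q N)
  missing-Missing p q N = go k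
    where
    go : ∀ m → let c = natrec k (λ c t → ifz (missed p q N c) t c) m in c < k → Missing p q N c
    go zero    lt = contradiction lt (<-irrefl refl)
    go (suc m) lt with missed p q N m in eq
    ... | zero  = go m lt
    ... | suc _ = missed⇒Missing p q N m λ z → 1+n≢0 (trans (sym eq) z)

  missing<k : ∀ p q N c → c < k → Missing p q N c → missing p q N < k
  missing<k p q N c c<k mis = go k c<k ≤-refl
    where
    go : ∀ m → c < m → m ≤ k → natrec k (λ c t → ifz (missed p q N c) t c) m < k
    go (suc m) c≤m m<k with missed p q N m in eq | m≤n⇒m<n∨m≡n (≤-pred c≤m)
    ... | suc _ | _         = m<k
    ... | zero  | inj₁ c<m  = go m c<m (<⇒≤ m<k)
    ... | zero  | inj₂ refl = contradiction eq (Missing⇒missed p q N c mis)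

  -- The difference `k ∸ missing` is positive exactly when some colour is missed. Larger segments
  -- override smaller ones, and the default 0 is trivially missed on the empty segment.
  latest : (ℕ → ℕ) → (ℕ → ℕ) → ℕ → ℕ
  latest p q = natrec 0 λ N t → ifz (k ∸ missing p q (suc N)) t (missing p q (suc N))

  latest<k : 0 < k → ∀ p q N → latest p q N < k
  latest<k 0<k p q zero = 0<k
  latest<k 0<k p q (suc N) with k ∸ missing p q (suc N) in eq
  ... | zero  = latest<k 0<k p q N
  ... | suc _ = m∸n≢0⇒n<m λ z → 1+n≢0 (trans (sym eq) z)

  -- The segment that decides `latest` is the largest admissible one up to `s`, hence includes [0,
  -- N); what is missed there is missed on [0, N).
  latest-Missing : ∀ p q c → c < k → ∀ N s → N ≤ s → Missing p q N c → Missing p q N (latest p q s)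
  latest-Missing p q c c<k zero    zero    N≤s mis b ()
  latest-Missing p q c c<k N (suc s) N≤s mis with k ∸ missing p q (suc s) in eq | m≤n⇒m<n∨m≡n N≤s
  ... | suc _ | _         = Missing-antitone N≤s
    (missing-Missing p q (suc s) (m∸n≢0⇒n<m λ z → 1+n≢0 (trans (sym eq) z)))
  ... | zero  | inj₁ N<1+s = latest-Missing p q c c<k N s (≤-pred N<1+s) mis
  ... | zero  | inj₂ refl = contradiction (m∸n≡0⇒m≤n eq) (<⇒≱ (missing<k p q N c c<k mis))

  -- The colour of s, where h lists the colours of s - 1, …, 0 in this order.
  next : ℕ → ℕ → ℕ → ℕ
  next e s h = latest (outside e s) (λ b → nth# (s ∸ suc b) h) s

  -- Course-of-values recursion: each colour depends on all earlier ones, which are therefore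
  -- carried along in a coded list.
  history : ℕ → ℕ → ℕ
  history e = natrec 0 λ s h → cons (next e s h) h

  colour : ℕ → ℕ → ℕ
  colour e s = next e s (history e s)

  nth-history : ∀ e s b → b < s → nth# (s ∸ suc b) (history e s) ≡ colour e b
  nth-history e (suc s) b b≤s with m≤n⇒m<n∨m≡n (≤-pred b≤s)
  ... | inj₂ refl rewrite n∸n≡0 s = head-cons _ _
  ... | inj₁ b<s rewrite +-∸-assoc 1 {s} {suc b} b<s =
    trans (nth#-suc (s ∸ suc b) _) (trans (cong (nth# (s ∸ suc b)) (tail-cons _ _)) (nth-history e s b b<s))

  missedᶜ : Computable f → Computable g → Computable h → Computable f₃ → Computable f₄ → Computable (λ v →
    missed (outside (f v) (g v)) (λ b → nth# (g v ∸ suc b) (h v)) (f₃ v) (f₄ v))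
  missedᶜ e s r N c = natrecᶜ (lit 1)
    (ifzᶜ (outsideᶜ (wk e) (wk s) (var v₀))
      (ifzᶜ (distᶜ (nth#ᶜ (wk s ∸ᶜ sucᶜ (var v₀)) (wk r)) (wk c)) zeroᶜ (var v₁))
      (var v₁))
    N

  missingᶜ : Computable f → Computable g → Computable h → Computable f₃ → Computable (λ v →
    missing (outside (f v) (g v)) (λ b → nth# (g v ∸ suc b) (h v)) (f₃ v))
  missingᶜ e s r N = natrecᶜ (lit k)
    (ifzᶜ (missedᶜ (wk e) (wk s) (wk r) (wk N) (var v₀)) (var v₁) (var v₀)) (lit k)

  nextᶜ : Computable f → Computable g → Computable h → Computable (λ v → next (f v) (g v) (h v))
  nextᶜ e s h = natrecᶜ zeroᶜ (ifzᶜ (lit k ∸ᶜ M) (var v₁) M) s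
    where M = missingᶜ (wk e) (wk s) (wk h) (sucᶜ (var v₀))

  colourᶜ : Computable f → Computable g → Computable (λ v → colour (f v) (g v))
  colourᶜ e s = nextᶜ e s
    (natrecᶜ zeroᶜ (consᶜ (nextᶜ (wk e) (var v₀) (var v₁)) (var v₁)) s)

bit-true : ∀ b → dist (suc (bit b)) 2 ≡ 0 → b ≡ true
bit-true true _ = refl

module Diagonal (k : ℕ) (0<k : 0 < k) where
  open Colouring k

  col : ℕ → ℕ → Fin k
  col e s = fromℕ< (latest<k 0<k (outside e s) (λ b → nth# (s ∸ suc b) (history e s)) s)

  toℕ-col : ∀ e s → toℕ (col e s) ≡ colour e s
  toℕ-col e s = toℕ-fromℕ< _

  col-computable : UniformlyComputableColorings k col
  col-computable = code c , λ i x →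
    subst (Eval ∅ (code c) (i ∷ x ∷ [])) (sym (toℕ-col i x)) (computes c (i ∷ x ∷ []))
    where
    c : Computable {2} (λ v → colour (lookup v v₀) (lookup v v₁))
    c = colourᶜ (var v₀) (var v₁)

  -- An infinite row is not thin for its colouring

  module _ (A : ℕ → Bool) (e : ℕ) (A-eval : ∀ x → Eval ∅′ (φ e) (e ∷ x ∷ []) (bit (A x))) where

    fresh-colour : Infinite (A) → ThinFor (A) (col e) → ∀ N →
      Σ ℕ λ x → N ≤ x × A x ≡ true × (∀ b → b < N → A b ≡ true → col e b ≢ col e x)
    fresh-colour inf (c₀ , thin) N
      with eventually-below (λ b → outside-limit e b (A-eval b)) N
    -- The element `x` is itself the stage used to colour it, so it must pass the threshold `s₀` as
    -- well as `N`.
    ... | s₀ , lim with inf (N ⊔ s₀)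
    ... | x , le , x∈A = x , N≤x , x∈A , λ b b<N b∈A same →
      latest-Missing p q (toℕ c₀) (toℕ<n c₀) N x N≤x c₀-missing b b<N
        (trans (lim x s₀≤x b b<N) (cong (λ a → dist (suc (bit a)) 2) b∈A))
        (trans (trans (q≡ b b<N) (cong toℕ same)) (toℕ-col e x))
      where
      p = outside e x
      q = λ b → nth# (x ∸ suc b) (history e x)
      N≤x  = m⊔n≤o⇒m≤o N s₀ le
      s₀≤x = m⊔n≤o⇒n≤o N s₀ le
      q≡ : ∀ b → b < N → q b ≡ toℕ (col e b)
      q≡ b b<N = trans (nth-history e x b (≤-trans b<N N≤x)) (sym (toℕ-col e b))
      -- The colour avoided by all of `A` only certifies that some colour is missed at stage `x`;
      -- the colour given to `x` may be another one.
      c₀-missing : Missing p q N (toℕ c₀)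
      c₀-missing b b<N pb qb = thin b (bit-true _ (trans (sym (lim x s₀≤x b b<N)) pb))
        (toℕ-injective (trans (sym (q≡ b b<N)) qb))

    -- Iterating `fresh-colour` would give `suc k` elements of `A` with pairwise different colours,
    -- against the pigeonhole principle.
    not-thin : Infinite (A) → ¬ ThinFor (A) (col e)
    not-thin inf thin =
      let i , j , i<j , same = pigeonhole (n<1+n k) (λ j → col e (point (toℕ j)))
      in proj₂ (proj₂ (proj₂ (fresh (bound (toℕ j))))) (point (toℕ i)) (point<bound (toℕ i) (toℕ j) i<j)
           (proj₁ (proj₂ (proj₂ (fresh (bound (toℕ i)))))) same
      where
      fresh = fresh-colour inf thin
      -- Each bound lies just above the previous point, so a new point avoids the colours of all
      -- earlier ones.
      bound point : ℕ → ℕ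
      bound zero    = 0
      bound (suc j) = suc (point j)
      point j = proj₁ (fresh (bound j))
      point<bound : ∀ i j → i < j → point i < bound j
      point<bound i (suc j) i≤j with m≤n⇒m<n∨m≡n (≤-pred i≤j)
      ... | inj₂ refl = ≤-refl
      ... | inj₁ i<j  = m≤n⇒m≤1+n (≤-trans (point<bound i j i<j) (proj₁ (proj₂ (fresh (bound j)))))

theorem5p19 : (k : ℕ) → 2 ≤ k →
    Σ (ℕ → ℕ → Fin k) λ f →
    UniformlyComputableColorings k f ×
    ¬ (Σ (ℕ → ℕ → Bool) λ A →
    ComputableSeqOfSetsRel ∅′ A ×
    (∀ i → Infinite (A i) × ThinFor (A i) (f i)))
theorem5p19 k 2≤k = col , col-computable , λ (A , (c , A-eval) , good) →
  -- The diagonal choice: the row whose number is an index of the code that computes the whole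
  -- sequence.
  let e = encode c
      inf , thin = good e
      row-eval = λ x → subst (λ c → Eval ∅′ c (e ∷ x ∷ []) (bit (A e x))) (sym (φ-encode c)) (A-eval e x)
  in not-thin (A e) e row-eval inf thin
  where open Diagonal k (<⇒≤ 2≤k)
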